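{- Let $G$ be a two-edge-connected graph with vertex set $[n]$, and let $e_i$ and $e_j$ be two (not necessarily distinct) edges of $G$. For $S\subseteq E(G)$, let $S$ also denote the graph with vertex set $[n]$ and edge set $S$. Then $$\sum_{\substack{S\subseteq E(G)\\ e_i\in S}}(-1)^{|S|}S+(1+t)\sum_{\substack{S\subseteq E(G)\\ e_j\notin S}}(-1)^{|S|}S$$ is a modular relation for $XB$.
   Context: Write $[n]=\{1,\dots,n\}$. A graph is a finite vertex set $V(G)$ together with a finite multiset $E(G)$ of unordered pairs of not necessarily distinct vertices (loops and multi-edges are allowed; parallel copies of an edge are regarded as distinct elements of $E(G)$ when taking subsets $S\subseteq E(G)$). A graph $G$ is two-edge-connected if it is connected and $G-e$ (delete the single edge $e$) is connected for every $e\in E(G)$; equivalently, for each partition of $V(G)$ into two nonempty blocks $B_1,B_2$ there are at least two edges with one endpoint in $B_1$ and the other in $B_2$. $\mathbb{G}$ is the $\mathbb{C}$-vector space freely generated by all (labelled) graphs whose vertex set is $[n]$ for some $n\ge 1$; $\mathbb{G}[t]$ consists of formal linear combinations of such graphs with coefficients in $\mathbb{C}[t]$. Tutte symmetric function: for a graph $G$, $XB_G=\sum_{\kappa}(1+t)^{e(\kappa)}\prod_{v\in V(G)}x_{\kappa(v)}$, where the sum is over all maps $\kappa:V(G)\to\{1,2,3,\dots\}$ and $e(\kappa)$ is the number of edges of $G$ (with multiplicity; every loop is counted) whose endpoints receive the same value under $\kappa$. Extend $\mathbb{C}[t]$-linearly to $XB:\mathbb{G}[t]\to\Lambda[t]$,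 where $\Lambda$ is the algebra of symmetric functions over $\mathbb{C}$ in $x_1,x_2,\dots$. Extension: $G\uplus E$ denotes the graph with vertex set $V(G)$ and edge multiset $E(G)\uplus E$ (multiplicities are added). For $L=\sum_{i} c_i(t)H_i$ with all $H_i$ graphs on $[n]$ and a graph $G'$ on $[N]$, $N\ge n$, set $Ext(L;G')=\sum_i c_i(t)\,(G'\uplus E(H_i))$. Modular relation: a linear combination $L\in\mathbb{G}[t]$ of graphs with vertex set $[n]$ is a modular relation for $XB$ if $Ext(L;G')\in Ker(XB)$ for every $N\ge n$ and every graph $G'$ with vertex set $[N]$. -}

module Defs where

open import Algebra.Bundles using (CommutativeRing)
open import Algebra.Bundles.Raw using (RawRing)
import Algebra.Definitions.RawSemiring as RawSemiringDefinitions
open import Data.Bool.Base using (if_then_else_)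
open import Data.Fin.Base using (Fin; inject≤; finToFun)
open import Data.Fin.Properties using (_≟_)
open import Data.Fin.Subset using (Subset; inside; outside; ∣_∣)
open import Data.List.Base using (List; []; _∷_; [_]; _++_; map; filter; foldr; length; removeAt)
open import Data.List.Membership.Propositional using (_∈_)
open import Data.Nat.Base using (ℕ; zero; suc; _≤_; NonZero)
import Data.Nat.Properties as ℕ
open import Data.Product.Base using (_×_; _,_; ∃)
open import Data.Vec.Base as Vec using (Vec; []; _∷_)
import Data.Vec.Properties as Vec
open import Level using (Level; _⊔_)
open import Relation.Binary.Construct.Closure.Equivalence using (EqClosure)
open import Relation.Nullary.Decidable using (does)
open import Relation.Unary using (Pred; Decidable)

-- A multigraph with vertex set [n], n ≥ 1.  The list represents the multiset
-- of edges: neither its order nor the orientation of a pair plays any role in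
-- the notions below.  An edge, as an element of E(G), is a position in the
-- list, so that parallel edges are distinct.
record Graph (n : ℕ) : Set where
  constructor mkGraph
  field
    nonEmpty : NonZero n
    edges    : List (Fin n × Fin n)

open Graph public

Edge : ∀ {n} → Graph n → Set
Edge G = Fin (length (edges G))

Connected : ∀ {n} → Graph n → Set
Connected {n} G = ∀ (u v : Fin n) → EqClosure (λ x y → (x , y) ∈ edges G) u v

_-ₑ_ : ∀ {n} (G : Graph n) → Edge G → Graph n
G -ₑ e = mkGraph (nonEmpty G) (removeAt (edges G) e)

TwoEdgeConnected : ∀ {n} → Graph n → Set
TwoEdgeConnected G = Connected G × (∀ (e : Edge G) → Connected (G -ₑ e))

EdgeSet : ∀ {n} → Graph n → Set
EdgeSet G = Subset (length (edges G))

select : ∀ {a} {A : Set a} (xs : List A) → Subset (length xs) → List A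
select []       []            = []
select (x ∷ xs) (inside  ∷ S) = x ∷ select xs S
select (x ∷ xs) (outside ∷ S) = select xs S

spanning : ∀ {n} (G : Graph n) → EdgeSet G → Graph n
spanning G S = mkGraph (nonEmpty G) (select (edges G) S)

subsets : ∀ m → List (Subset m)
subsets zero    = [ [] ]
subsets (suc m) = map (outside ∷_) (subsets m) ++ map (inside ∷_) (subsets m)

-- G ⊎ E(H), where [n] is identified with the initial segment of [N].
_⊎E[_⟨_⟩] : ∀ {n N} → Graph N → Graph n → n ≤ N → Graph N
G ⊎E[ H ⟨ n≤N ⟩] =
  mkGraph (nonEmpty G)
          (edges G ++ map (λ (u , v) → inject≤ u n≤N , inject≤ v n≤N) (edges H))

-- e(κ)
monochromatic : ∀ {n k} → Graph n → (Fin n → Fin k) → ℕ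
monochromatic G κ = length (filter (λ (u , v) → κ u ≟ κ v) (edges G))

-- The exponent vector of ∏ᵥ x_κ(v).
exponents : ∀ {n k} → (Fin n → Fin k) → Vec ℕ k
exponents {n} κ = Vec.tabulate λ c → Vec.count (λ v → κ v ≟ c) (Vec.allFin n)

-- The ring R of scalars takes the place of ℂ.
module Tutte {r ℓ : Level} (R : CommutativeRing r ℓ) where

  private module R = CommutativeRing R

  -- R[t]: lists of coefficients, constant term first, compared coefficientwise
  -- (so that trailing zeros are immaterial).
  R[t] : RawRing r ℓ
  R[t] = record
    { Carrier = List R.Carrier
    ; _≈_     = λ p q → ∀ i → coefficient p i R.≈ coefficient q i
    ; _+_     = add
    ; _*_     = mul
    ; -_      = map (λ a → R.- a)
    ; 0#      = []
    ; 1#      = [ R.1# ]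
    }
    where
    coefficient : List R.Carrier → ℕ → R.Carrier
    coefficient []      _       = R.0#
    coefficient (a ∷ p) zero    = a
    coefficient (a ∷ p) (suc i) = coefficient p i

    add : List R.Carrier → List R.Carrier → List R.Carrier
    add []      q       = q
    add (a ∷ p) []      = a ∷ p
    add (a ∷ p) (b ∷ q) = a R.+ b ∷ add p q

    mul : List R.Carrier → List R.Carrier → List R.Carrier
    mul []      q = []
    mul (a ∷ p) q = add (map (a R.*_) q) (R.0# ∷ mul p q)

  open RawRing R[t] public using (_≈_; _+_; _*_; -_; 0#; 1#)
    renaming (Carrier to Poly)
  open RawSemiringDefinitions (RawRing.rawSemiring R[t]) public using (_^_; sum)

  t : Poly
  t = R.0# ∷ R.1# ∷ []

  -- Formal R[t]-linear combinations of elements of X, as lists of terms.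
  LinComb : ∀ {x} → Set x → Set (r ⊔ x)
  LinComb X = List (Poly × X)

  infixl 6 _⊕_
  infixr 7 _·_

  _⊕_ : ∀ {x} {X : Set x} → LinComb X → LinComb X → LinComb X
  _⊕_ = _++_

  _·_ : ∀ {x} {X : Set x} → Poly → LinComb X → LinComb X
  c · L = map (λ (d , H) → c * d , H) L

  𝔾[t] : Set r
  𝔾[t] = LinComb (∃ Graph)

  -- Power series in x₁, x₂, … over R[t]: for every k, the coefficients of the
  -- monomials in x₁, …, xₖ.  This ambient ring of Λ[t] serves as the codomain
  -- of XB; the kernel does not depend on that choice.
  Series : Set r
  Series = ∀ k → Vec ℕ k → Poly

  -- If x^α involves only x₁, …, xₖ, then every κ with ∏ᵥ x_κ(v) = x^α takes its
  -- values in [k], so the coefficient of x^α is a sum over the finitely many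
  -- maps [n] → [k]; finToFun enumerates them.
  XBᴳ : ∃ Graph → Series
  XBᴳ (n , G) k α = sum λ i → term (finToFun {k} {n} i)
    where
    term : (Fin n → Fin k) → Poly
    term κ = if does (Vec.≡-dec ℕ._≟_ (exponents κ) α)
             then (1# + t) ^ monochromatic G κ
             else 0#

  XB : 𝔾[t] → Series
  XB L k α = foldr (λ (c , G) s → c * XBᴳ G k α + s) 0# L

  _∈KerXB : 𝔾[t] → Set ℓ
  L ∈KerXB = ∀ k (α : Vec ℕ k) → XB L k α ≈ 0#

  Ext : ∀ {n N} → LinComb (Graph n) → n ≤ N → Graph N → 𝔾[t]
  Ext {N = N} L n≤N G′ = map (λ (c , H) → c , N , G′ ⊎E[ H ⟨ n≤N ⟩]) L

  IsModularRelation : ∀ {n} → LinComb (Graph n) → Set ℓ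
  IsModularRelation {n} L = ∀ N (n≤N : n ≤ N) (G′ : Graph N) → Ext L n≤N G′ ∈KerXB

  -- Σ (-1)^|S| S over the S ⊆ E(G) that satisfy P.
  alternatingSum : ∀ {n p} (G : Graph n) {P : Pred (EdgeSet G) p} →
                   Decidable P → LinComb (Graph n)
  alternatingSum G P? =
    map (λ S → (- 1#) ^ ∣ S ∣ , spanning G S) (filter P? (subsets (length (edges G))))

{-# OPTIONS --safe #-}

-- Fix κ and let w(e) be 1+t or 1 according as e is monochromatic or not.  Then
-- the two signed sums over S factor as −w(eᵢ) ∏_{e≠eᵢ} (1 − w(e)) and
-- ∏_{e≠eⱼ} (1 − w(e)).  If κ is constant on [n], both products are (−t)^(|E|−1)
-- and the two contributions cancel.  Otherwise G − eᵢ and G − eⱼ, being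
-- connected, both contain an edge that is not monochromatic, so that both
-- products vanish.
module Submission where

open import Defs
open import Algebra.Bundles using (CommutativeRing; Semiring)
import Algebra.Definitions.RawSemiring as RawSemiringDefinitions
import Algebra.Properties.CommutativeMonoid.Sum as CommutativeMonoidSum
import Algebra.Properties.CommutativeSemigroup as CommutativeSemigroupProperties
import Algebra.Properties.Ring as RingProperties
import Algebra.Properties.Semiring.Sum as SemiringSum
open import Algebra.Structures using (IsCommutativeRing)
open import Data.Bool.Base using (Bool; true; false; not; if_then_else_)
open import Data.Fin.Base using (Fin; zero; suc; inject≤; finToFun)
open import Data.Fin.Properties using (_≟_)
open import Data.Fin.Subset using (Subset; inside; outside; ∣_∣)
open import Data.Fin.Subset.Properties using (_∈?_)
open import Data.List.Base using (List; []; _∷_; _++_; map; filter; foldr; length; lookup; removeAt)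
open import Data.List.Membership.Propositional.Properties using (∈-lookup)
open import Data.List.Properties using (foldr-map; length-removeAt)
open import Data.List.Relation.Unary.All as All using (All; []; _∷_; all?)
open import Data.List.Relation.Unary.All.Properties using (¬All⇒Any¬)
open import Data.List.Relation.Unary.Any as Any using (Any; here; there)
open import Data.Nat.Base using (ℕ; zero; suc; pred; _≤_)
import Data.Nat.Properties as ℕ
open import Data.Product.Base using (_×_; _,_; proj₁)
import Data.Vec.Properties as Vec
open import Data.Vec.Base using (_∷_)
open import Level using (Level)
open import Relation.Binary.Construct.Closure.Equivalence using (gfold)
open import Relation.Binary.PropositionalEquality as ≡ using (_≡_)
import Relation.Binary.Reasoning.Setoid as SetoidReasoning
open import Relation.Nullary.Decidable using (¬?; does; yes; no; dec-true; dec-false)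
open import Relation.Nullary.Negation using (¬_)
open import Relation.Unary using (Pred; Decidable)

-- Polynomials as lists of coefficients

module PolynomialRing {r ℓ : Level} (R : CommutativeRing r ℓ) where

  open Tutte R
  private module R = CommutativeRing R
  open RingProperties R.ring using (-0#≈0#)

  coeff : Poly → ℕ → R.Carrier
  coeff []      _       = R.0#
  coeff (a ∷ p) zero    = a
  coeff (a ∷ p) (suc i) = coeff p i

  -- Unlike _≈_, which unfolds to a function type, this record lets Agda infer
  -- both sides.
  infix 4 _≋_
  record _≋_ (p q : Poly) : Set ℓ where
    constructor coeffwise
    field coeff-≈ : ∀ i → coeff p i R.≈ coeff q i
  open _≋_

  -- `coeff` repeats a function local to the definition of `R[t]`. Neither computes on an unknown
  -- list, so both lists and the index are split until the two sides reduce.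
  ≈⇒≋ : ∀ p q → p ≈ q → p ≋ q
  ≈⇒≋ p q p≈q = coeffwise (go p q p≈q)
    where
    go : ∀ p q → p ≈ q → ∀ i → coeff p i R.≈ coeff q i
    go []      []      h i       = R.refl
    go []      (b ∷ q) h zero    = h zero
    go []      (b ∷ q) h (suc i) = go [] q (λ j → h (suc j)) i
    go (a ∷ p) []      h zero    = h zero
    go (a ∷ p) []      h (suc i) = go p [] (λ j → h (suc j)) i
    go (a ∷ p) (b ∷ q) h zero    = h zero
    go (a ∷ p) (b ∷ q) h (suc i) = go p q (λ j → h (suc j)) i

  ≋⇒≈ : ∀ p q → p ≋ q → p ≈ q
  ≋⇒≈ p q p≋q = go p q (coeff-≈ p≋q)
    where
    go : ∀ p q → (∀ i → coeff p i R.≈ coeff q i) → p ≈ q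
    go []      []      h i       = R.refl
    go []      (b ∷ q) h zero    = h zero
    go []      (b ∷ q) h (suc i) = go [] q (λ j → h (suc j)) i
    go (a ∷ p) []      h zero    = h zero
    go (a ∷ p) []      h (suc i) = go p [] (λ j → h (suc j)) i
    go (a ∷ p) (b ∷ q) h zero    = h zero
    go (a ∷ p) (b ∷ q) h (suc i) = go p q (λ j → h (suc j)) i

  ≋-refl : ∀ {p} → p ≋ p
  ≋-refl = coeffwise λ _ → R.refl

  ≋-sym : ∀ {p q} → p ≋ q → q ≋ p
  ≋-sym h = coeffwise λ i → R.sym (coeff-≈ h i)

  ≋-trans : ∀ {p q s} → p ≋ q → q ≋ s → p ≋ s
  ≋-trans h k = coeffwise λ i → R.trans (coeff-≈ h i) (coeff-≈ k i)

  scale : R.Carrier → Poly → Poly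
  scale a = map (a R.*_)

  coeff-+ : ∀ p q i → coeff (p + q) i R.≈ coeff p i R.+ coeff q i
  coeff-+ []      q       i       = R.sym (R.+-identityˡ _)
  coeff-+ (a ∷ p) []      i       = R.sym (R.+-identityʳ _)
  coeff-+ (a ∷ p) (b ∷ q) zero    = R.refl
  coeff-+ (a ∷ p) (b ∷ q) (suc i) = coeff-+ p q i

  coeff-neg : ∀ p i → coeff (- p) i R.≈ R.- coeff p i
  coeff-neg []      i       = R.sym -0#≈0#
  coeff-neg (a ∷ p) zero    = R.refl
  coeff-neg (a ∷ p) (suc i) = coeff-neg p i

  coeff-scale : ∀ a p i → coeff (scale a p) i R.≈ a R.* coeff p i
  coeff-scale a []      i       = R.sym (R.zeroʳ a)
  coeff-scale a (b ∷ p) zero    = R.refl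
  coeff-scale a (b ∷ p) (suc i) = coeff-scale a p i

  +-cong : ∀ {p p′ q q′} → p ≋ p′ → q ≋ q′ → p + q ≋ p′ + q′
  +-cong {p} {p′} {q} {q′} h k = coeffwise λ i →
    R.trans (coeff-+ p q i)
      (R.trans (R.+-cong (coeff-≈ h i) (coeff-≈ k i)) (R.sym (coeff-+ p′ q′ i)))

  +-congˡ : ∀ p {q q′} → q ≋ q′ → p + q ≋ p + q′
  +-congˡ p = +-cong ≋-refl

  +-comm : ∀ p q → p + q ≋ q + p
  +-comm p q = coeffwise λ i →
    R.trans (coeff-+ p q i) (R.trans (R.+-comm _ _) (R.sym (coeff-+ q p i)))

  +-assoc : ∀ p q s → (p + q) + s ≋ p + (q + s)
  +-assoc p q s = coeffwise λ i → begin
    coeff ((p + q) + s) i                     ≈⟨ coeff-+ (p + q) s i ⟩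
    coeff (p + q) i R.+ coeff s i             ≈⟨ R.+-congʳ (coeff-+ p q i) ⟩
    (coeff p i R.+ coeff q i) R.+ coeff s i   ≈⟨ R.+-assoc _ _ _ ⟩
    coeff p i R.+ (coeff q i R.+ coeff s i)   ≈⟨ R.+-congˡ (coeff-+ q s i) ⟨
    coeff p i R.+ coeff (q + s) i             ≈⟨ coeff-+ p (q + s) i ⟨
    coeff (p + (q + s)) i                     ∎
    where open SetoidReasoning R.setoid

  +-identityʳ : ∀ p → p + 0# ≋ p
  +-identityʳ p = +-comm p 0#

  +-inverseʳ : ∀ p → p + (- p) ≋ 0#
  +-inverseʳ p = coeffwise λ i →
    R.trans (coeff-+ p (- p) i)
      (R.trans (R.+-congˡ (coeff-neg p i)) (R.-‿inverseʳ _))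

  neg-cong : ∀ {p q} → p ≋ q → (- p) ≋ (- q)
  neg-cong {p} {q} h = coeffwise λ i →
    R.trans (coeff-neg p i) (R.trans (R.-‿cong (coeff-≈ h i)) (R.sym (coeff-neg q i)))

  ∷-cong : ∀ {a b p q} → a R.≈ b → p ≋ q → a ∷ p ≋ b ∷ q
  ∷-cong a≈b h = coeffwise λ { zero → a≈b ; (suc i) → coeff-≈ h i }

  -- Prepending `R.0#` is multiplication by t. Applied to the zero polynomial it leaves a trailing
  -- zero, which only the coefficientwise comparison discards.
  0∷0 : R.0# ∷ 0# ≋ 0#
  0∷0 = coeffwise λ { zero → R.refl ; (suc i) → R.refl }

  0∷-+ : ∀ p q → R.0# ∷ (p + q) ≋ (R.0# ∷ p) + (R.0# ∷ q)
  0∷-+ p q = ∷-cong (R.sym (R.+-identityˡ _)) ≋-refl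

  scale-cong : ∀ {a b p q} → a R.≈ b → p ≋ q → scale a p ≋ scale b q
  scale-cong {a} {b} {p} {q} a≈b h = coeffwise λ i →
    R.trans (coeff-scale a p i)
      (R.trans (R.*-cong a≈b (coeff-≈ h i)) (R.sym (coeff-scale b q i)))

  scale-+ : ∀ a p q → scale a (p + q) ≋ scale a p + scale a q
  scale-+ a p q = coeffwise λ i → begin
    coeff (scale a (p + q)) i                       ≈⟨ coeff-scale a (p + q) i ⟩
    a R.* coeff (p + q) i                           ≈⟨ R.*-congˡ (coeff-+ p q i) ⟩
    a R.* (coeff p i R.+ coeff q i)                 ≈⟨ R.distribˡ a _ _ ⟩
    a R.* coeff p i R.+ a R.* coeff q i
      ≈⟨ R.+-cong (coeff-scale a p i) (coeff-scale a q i) ⟨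
    coeff (scale a p) i R.+ coeff (scale a q) i     ≈⟨ coeff-+ (scale a p) (scale a q) i ⟨
    coeff (scale a p + scale a q) i                 ∎
    where open SetoidReasoning R.setoid

  scale-scale : ∀ a b p → scale (a R.* b) p ≋ scale a (scale b p)
  scale-scale a b []      = ≋-refl
  scale-scale a b (c ∷ p) = ∷-cong (R.*-assoc a b c) (scale-scale a b p)

  scale-0 : ∀ p → scale R.0# p ≋ 0#
  scale-0 p = coeffwise λ i → R.trans (coeff-scale R.0# p i) (R.zeroˡ _)

  scale-1 : ∀ p → scale R.1# p ≋ p
  scale-1 p = coeffwise λ i → R.trans (coeff-scale R.1# p i) (R.*-identityˡ _)

  +-swap : ∀ p q s → p + (q + s) ≋ q + (p + s)
  +-swap p q s =
    ≋-trans (≋-sym (+-assoc p q s))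
      (≋-trans (+-cong (+-comm p q) ≋-refl) (+-assoc q p s))

  +-interchange : ∀ p q s u → (p + q) + (s + u) ≋ (p + s) + (q + u)
  +-interchange p q s u =
    ≋-trans (+-assoc p q (s + u))
      (≋-trans (+-congˡ p (+-swap q s u)) (≋-sym (+-assoc p s (q + u))))

  -- Multiplication of polynomials

  *-zeroʳ : ∀ p → p * 0# ≋ 0#
  *-zeroʳ []      = ≋-refl
  *-zeroʳ (a ∷ p) = ≋-trans (∷-cong R.refl (*-zeroʳ p)) 0∷0

  -- The product recurses on its left factor only. This is the mirrored recursion on the right
  -- factor, which is what the induction for commutativity needs.
  *-∷ : ∀ p b q → p * (b ∷ q) ≋ scale b p + (R.0# ∷ p * q)
  *-∷ []      b q = ≋-sym 0∷0
  *-∷ (a ∷ p) b q = ∷-cong (R.+-congʳ (R.*-comm a b))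
    (≋-trans (+-congˡ (scale a q) (*-∷ p b q)) (+-swap (scale a q) (scale b p) _))

  *-comm : ∀ p q → p * q ≋ q * p
  *-comm []      q = ≋-sym (*-zeroʳ q)
  *-comm (a ∷ p) q =
    ≋-trans (+-congˡ (scale a q) (∷-cong R.refl (*-comm p q))) (≋-sym (*-∷ q a p))

  *-congˡ : ∀ p {q q′} → q ≋ q′ → p * q ≋ p * q′
  *-congˡ []      h = ≋-refl
  *-congˡ (a ∷ p) h = +-cong (scale-cong R.refl h) (∷-cong R.refl (*-congˡ p h))

  *-cong : ∀ {p p′ q q′} → p ≋ p′ → q ≋ q′ → p * q ≋ p′ * q′
  *-cong {p} {p′} {q} {q′} h k =
    ≋-trans (*-congˡ p k)
      (≋-trans (*-comm p q′) (≋-trans (*-congˡ q′ h) (*-comm q′ p′)))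

  *-distribˡ-+ : ∀ p q s → p * (q + s) ≋ p * q + p * s
  *-distribˡ-+ []      q s = ≋-refl
  *-distribˡ-+ (a ∷ p) q s =
    ≋-trans
      (+-cong (scale-+ a q s)
              (≋-trans (∷-cong R.refl (*-distribˡ-+ p q s)) (0∷-+ (p * q) (p * s))))
      (+-interchange (scale a q) (scale a s) (R.0# ∷ p * q) (R.0# ∷ p * s))

  *-distribʳ-+ : ∀ p q s → (q + s) * p ≋ q * p + s * p
  *-distribʳ-+ p q s =
    ≋-trans (*-comm (q + s) p)
      (≋-trans (*-distribˡ-+ p q s) (+-cong (*-comm p q) (*-comm p s)))

  scale-* : ∀ a p q → scale a p * q ≋ scale a (p * q)
  scale-* a []      q = ≋-refl
  scale-* a (b ∷ p) q =
    ≋-trans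
      (+-cong (scale-scale a b q) (∷-cong (R.sym (R.zeroʳ a)) (scale-* a p q)))
      (≋-sym (scale-+ a (scale b q) (R.0# ∷ p * q)))

  0∷-* : ∀ p q → (R.0# ∷ p) * q ≋ R.0# ∷ p * q
  0∷-* p q = +-cong (scale-0 q) ≋-refl

  *-assoc : ∀ p q s → (p * q) * s ≋ p * (q * s)
  *-assoc []      q s = ≋-refl
  *-assoc (a ∷ p) q s =
    ≋-trans (*-distribʳ-+ s (scale a q) (R.0# ∷ p * q))
      (+-cong (scale-* a q s)
              (≋-trans (0∷-* (p * q) s) (∷-cong R.refl (*-assoc p q s))))

  *-identityˡ : ∀ p → 1# * p ≋ p
  *-identityˡ p = ≋-trans (+-cong (scale-1 p) 0∷0) (+-identityʳ p)

  *-identityʳ : ∀ p → p * 1# ≋ p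
  *-identityʳ p = ≋-trans (*-comm p 1#) (*-identityˡ p)

  -- Stated for `_≈_` rather than `_≋_`, so that results about arbitrary commutative rings apply as
  -- they stand to the equality in the definition of the kernel.
  isCommutativeRing : IsCommutativeRing _≈_ _+_ _*_ -_ 0# 1#
  isCommutativeRing = record
    { isRing = record
      { +-isAbelianGroup = record
        { isGroup = record
          { isMonoid = record
            { isSemigroup = record
              { isMagma = record
                { isEquivalence = record
                  { refl  = λ {p} → ≋⇒≈ p p ≋-refl
                  ; sym   = λ {p} {q} h → ≋⇒≈ q p (≋-sym (≈⇒≋ p q h))
                  ; trans = λ {p} {q} {s} h k →
                      ≋⇒≈ p s (≋-trans (≈⇒≋ p q h) (≈⇒≋ q s k))
                  }
                ; ∙-cong = λ {p} {p′} {q} {q′} h k →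
                    ≋⇒≈ (p + q) (p′ + q′) (+-cong (≈⇒≋ p p′ h) (≈⇒≋ q q′ k))
                }
              ; assoc = λ p q s → ≋⇒≈ ((p + q) + s) (p + (q + s)) (+-assoc p q s)
              }
            ; identity = (λ p → ≋⇒≈ p p ≋-refl) , (λ p → ≋⇒≈ (p + 0#) p (+-identityʳ p))
            }
          ; inverse =
              (λ p → ≋⇒≈ (- p + p) 0# (≋-trans (+-comm (- p) p) (+-inverseʳ p))) ,
              (λ p → ≋⇒≈ (p + (- p)) 0# (+-inverseʳ p))
          ; ⁻¹-cong = λ {p} {q} h → ≋⇒≈ (- p) (- q) (neg-cong (≈⇒≋ p q h))
          }
        ; comm = λ p q → ≋⇒≈ (p + q) (q + p) (+-comm p q)
        }
      ; *-cong = λ {p} {p′} {q} {q′} h k →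
          ≋⇒≈ (p * q) (p′ * q′) (*-cong (≈⇒≋ p p′ h) (≈⇒≋ q q′ k))
      ; *-assoc = λ p q s → ≋⇒≈ ((p * q) * s) (p * (q * s)) (*-assoc p q s)
      ; *-identity =
          (λ p → ≋⇒≈ (1# * p) p (*-identityˡ p)) , (λ p → ≋⇒≈ (p * 1#) p (*-identityʳ p))
      ; distrib =
          (λ p q s → ≋⇒≈ (p * (q + s)) (p * q + p * s) (*-distribˡ-+ p q s)) ,
          (λ p q s → ≋⇒≈ ((q + s) * p) (q * p + s * p) (*-distribʳ-+ p q s))
      }
    ; *-comm = λ p q → ≋⇒≈ (p * q) (q * p) (*-comm p q)
    }

  commutativeRing : CommutativeRing r ℓ
  commutativeRing = record { isCommutativeRing = isCommutativeRing }

-- Connectivity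

module _ {n k : ℕ} (κ : Fin n → Fin k) where

  Monochromatic : Fin n × Fin n → Set
  Monochromatic (u , v) = κ u ≡ κ v

  monochromatic? : Decidable Monochromatic
  monochromatic? (u , v) = κ u ≟ κ v

  -- Having equal colours is an equivalence relation on the vertices. Once it contains every edge,
  -- it contains the equivalence closure of the edges, which relates all vertices.
  connected⇒constant : (G : Graph n) → Connected G → All Monochromatic (edges G) →
                       ∀ u v → κ u ≡ κ v
  connected⇒constant G connected mono u v =
    gfold ≡.isEquivalence κ (All.lookup mono) (connected u v)

  -- If every edge of G - e were monochromatic, connectedness of G - e would make κ constant. Then e
  -- itself would be monochromatic too, against the assumption on G.
  non-monochromatic : (G : Graph n) → TwoEdgeConnected G → ¬ All Monochromatic (edges G) →
                      ∀ e → Any (λ e′ → ¬ Monochromatic e′) (edges (G -ₑ e))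
  non-monochromatic G (_ , connected) ¬mono e =
    ¬All⇒Any¬ monochromatic? (edges (G -ₑ e)) λ mono →
      ¬mono (All.tabulate λ _ → connected⇒constant (G -ₑ e) (connected e) mono _ _)

-- Expansions over subsets of a list

module Expansion {a ℓ : Level} (A : CommutativeRing a ℓ) where

  open CommutativeRing A hiding (zero)
  open RawSemiringDefinitions (Semiring.rawSemiring semiring) using (_^_; sum)
  open RingProperties ring using (-1*x≈-x)
  open CommutativeMonoidSum +-commutativeMonoid
    using (∑-distrib-+; sum-cong-≋; sum-replicate-zero)
  open SemiringSum semiring using (*-distribˡ-sum)
  private module *ₚ = CommutativeSemigroupProperties *-commutativeSemigroup
  open SetoidReasoning setoid

  private variable
    a′ p : Level
    X Y : Set a′

  -- Sums and products over lists

  ∑ : (X → Carrier) → List X → Carrier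
  ∑ f = foldr (λ x s → f x + s) 0#

  ∏ : (X → Carrier) → List X → Carrier
  ∏ f = foldr (λ x s → f x * s) 1#

  ∑-cong : {f g : X → Carrier} → (∀ x → f x ≈ g x) → ∀ xs → ∑ f xs ≈ ∑ g xs
  ∑-cong f≈g []       = refl
  ∑-cong f≈g (x ∷ xs) = +-cong (f≈g x) (∑-cong f≈g xs)

  ∑-map : (f : Y → Carrier) (g : X → Y) → ∀ xs → ∑ f (map g xs) ≡ ∑ (λ x → f (g x)) xs
  ∑-map f g = foldr-map _ g 0#

  ∑-++ : (f : X → Carrier) → ∀ xs ys → ∑ f (xs ++ ys) ≈ ∑ f xs + ∑ f ys
  ∑-++ f []       ys = sym (+-identityˡ _)
  ∑-++ f (x ∷ xs) ys = trans (+-congˡ (∑-++ f xs ys)) (sym (+-assoc _ _ _))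

  ∑-*ˡ : ∀ c (f : X → Carrier) → ∀ xs → ∑ (λ x → c * f x) xs ≈ c * ∑ f xs
  ∑-*ˡ c f []       = sym (zeroʳ c)
  ∑-*ˡ c f (x ∷ xs) = trans (+-congˡ (∑-*ˡ c f xs)) (sym (distribˡ c _ _))

  ∑-0 : (xs : List X) → ∑ (λ _ → 0#) xs ≈ 0#
  ∑-0 []       = refl
  ∑-0 (x ∷ xs) = trans (+-identityˡ _) (∑-0 xs)

  ∑-filter : {P : Pred X p} (P? : Decidable P) (f : X → Carrier) → ∀ xs →
             ∑ f (filter P? xs) ≈ ∑ (λ x → if does (P? x) then f x else 0#) xs
  ∑-filter P? f []       = refl
  ∑-filter P? f (x ∷ xs) with does (P? x)
  ... | true  = +-congˡ (∑-filter P? f xs)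
  ... | false = trans (∑-filter P? f xs) (sym (+-identityˡ _))

  ∑-sum : ∀ {m} (f : X → Fin m → Carrier) → ∀ xs →
          ∑ (λ x → sum (f x)) xs ≈ sum (λ i → ∑ (λ x → f x i) xs)
  ∑-sum {m = m} f []       = sym (sum-replicate-zero m)
  ∑-sum         f (x ∷ xs) =
    trans (+-congˡ (∑-sum f xs)) (sym (∑-distrib-+ (f x) (λ i → ∑ (λ y → f y i) xs)))

  ∏-++ : (f : X → Carrier) → ∀ xs ys → ∏ f (xs ++ ys) ≈ ∏ f xs * ∏ f ys
  ∏-++ f []       ys = sym (*-identityˡ _)
  ∏-++ f (x ∷ xs) ys = trans (*-congˡ (∏-++ f xs ys)) (sym (*-assoc _ _ _))

  ∏-map : (f : Y → Carrier) (g : X → Y) → ∀ xs → ∏ f (map g xs) ≡ ∏ (λ x → f (g x)) xs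
  ∏-map f g = foldr-map _ g 1#

  ∏-const : ∀ {f : X → Carrier} {c xs} → All (λ x → f x ≈ c) xs → ∏ f xs ≈ c ^ length xs
  ∏-const []          = refl
  ∏-const (fx≈c ∷ hs) = *-cong fx≈c (∏-const hs)

  ∏-0 : ∀ {f : X → Carrier} {xs} → Any (λ x → f x ≈ 0#) xs → ∏ f xs ≈ 0#
  ∏-0 (here fx≈0) = trans (*-congʳ fx≈0) (zeroˡ _)
  ∏-0 (there h)   = trans (*-congˡ (∏-0 h)) (zeroʳ _)

  -- Turns a power such as (1+t)^e(κ) into a product of one factor per edge, which is multiplicative
  -- under union of edge multisets.
  ^-length-filter : {P : Pred X p} (P? : Decidable P) → ∀ q xs →
                    q ^ length (filter P? xs) ≈ ∏ (λ x → if does (P? x) then q else 1#) xs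
  ^-length-filter P? q []       = refl
  ^-length-filter P? q (x ∷ xs) with does (P? x)
  ... | true  = *-congˡ (^-length-filter P? q xs)
  ... | false = trans (^-length-filter P? q xs) (sym (*-identityˡ _))

  -- Signed sums over subsets and their factorisations

  module _ (w : X → Carrier) where

    signed : ∀ xs → Subset (length xs) → Carrier
    signed xs S = (- 1#) ^ ∣ S ∣ * ∏ w (select xs S)

    signed-inside : ∀ x xs S → signed (x ∷ xs) (inside ∷ S) ≈ - w x * signed xs S
    signed-inside x xs S = begin
      (- 1# * s) * (w x * W)   ≈⟨ *ₚ.interchange (- 1#) s (w x) W ⟩
      (- 1# * w x) * (s * W)   ≈⟨ *-congʳ (-1*x≈-x (w x)) ⟩
      - w x * (s * W)          ∎
      where
      s = (- 1#) ^ ∣ S ∣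
      W = ∏ w (select xs S)

    -- With a Boolean test instead of a filtered list, a condition is restricted to the subsets with
    -- or without the head by precomposition, and membership tests then reduce by computation.
    ∑-subsets : ∀ xs → (Subset (length xs) → Bool) → Carrier
    ∑-subsets xs b = ∑ (λ S → if b S then signed xs S else 0#) (subsets (length xs))

    -- Subsets are separated by whether they contain the head. Including it contributes one sign and
    -- one weight, hence the factor `- w x`.
    ∑-subsets-∷ : ∀ x xs b → ∑-subsets (x ∷ xs) b ≈
                  ∑-subsets xs (λ S → b (outside ∷ S)) +
                  - w x * ∑-subsets xs (λ S → b (inside ∷ S))
    ∑-subsets-∷ x xs b = begin
      ∑ f (map (outside ∷_) Ss ++ map (inside ∷_) Ss)
        ≈⟨ ∑-++ f (map (outside ∷_) Ss) (map (inside ∷_) Ss) ⟩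
      ∑ f (map (outside ∷_) Ss) + ∑ f (map (inside ∷_) Ss)
        ≡⟨ ≡.cong₂ _+_ (∑-map f (outside ∷_) Ss) (∑-map f (inside ∷_) Ss) ⟩
      ∑-subsets xs (λ S → b (outside ∷ S)) + ∑ (λ S → f (inside ∷ S)) Ss
        ≈⟨ +-congˡ (∑-cong f-inside Ss) ⟩
      ∑-subsets xs (λ S → b (outside ∷ S)) + ∑ (λ S → - w x * g S) Ss
        ≈⟨ +-congˡ (∑-*ˡ (- w x) g Ss) ⟩
      ∑-subsets xs (λ S → b (outside ∷ S)) + - w x * ∑ g Ss
        ∎
      where
      Ss = subsets (length xs)
      f : Subset (length (x ∷ xs)) → Carrier
      f S = if b S then signed (x ∷ xs) S else 0#
      g : Subset (length xs) → Carrier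
      g S = if b (inside ∷ S) then signed xs S else 0#
      f-inside : ∀ S → f (inside ∷ S) ≈ - w x * g S
      f-inside S with b (inside ∷ S)
      ... | true  = signed-inside x xs S
      ... | false = sym (zeroʳ _)

    -- Used when the condition ignores the head: both halves of `∑-subsets-∷` then carry the same
    -- sum y.
    [1-w]* : ∀ x y → y + - w x * y ≈ (1# - w x) * y
    [1-w]* x y = trans (+-congʳ (sym (*-identityˡ y))) (sym (distribʳ y 1# (- w x)))

    -- Expanding the product means choosing 1 or `- w x` in each factor; the chosen entries form S.
    ∑-subsets-true : ∀ xs → ∑-subsets xs (λ _ → true) ≈ ∏ (λ x → 1# - w x) xs
    ∑-subsets-true []       = trans (+-identityʳ _) (*-identityˡ 1#)
    ∑-subsets-true (x ∷ xs) = begin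
      ∑-subsets (x ∷ xs) (λ _ → true)  ≈⟨ ∑-subsets-∷ x xs (λ _ → true) ⟩
      T + - w x * T                    ≈⟨ [1-w]* x T ⟩
      (1# - w x) * T                   ≈⟨ *-congˡ (∑-subsets-true xs) ⟩
      (1# - w x) * ∏ (λ x → 1# - w x) xs ∎
      where T = ∑-subsets xs (λ _ → true)

    -- Membership of `i` forces the choice of -w in its factor, while every other factor 1 - w stays
    -- complete.
    ∑-subsets-∋ : ∀ xs i → ∑-subsets xs (λ S → does (i ∈? S)) ≈
                  - w (lookup xs i) * ∏ (λ x → 1# - w x) (removeAt xs i)
    ∑-subsets-∋ (x ∷ xs) zero = begin
      ∑-subsets (x ∷ xs) (λ S → does (zero ∈? S))
        ≈⟨ ∑-subsets-∷ x xs (λ S → does (zero ∈? S)) ⟩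
      -- The head alone decides the test here, so on the tails it reduces to a constant.
      ∑-subsets xs (λ _ → false) + - w x * ∑-subsets xs (λ _ → true)
        ≈⟨ +-cong (∑-0 (subsets (length xs))) (*-congˡ (∑-subsets-true xs)) ⟩
      0# + - w x * ∏ (λ x → 1# - w x) xs
        ≈⟨ +-identityˡ _ ⟩
      - w x * ∏ (λ x → 1# - w x) xs
        ∎
    ∑-subsets-∋ (x ∷ xs) (suc i) = begin
      ∑-subsets (x ∷ xs) (λ S → does (suc i ∈? S))
        ≈⟨ ∑-subsets-∷ x xs (λ S → does (suc i ∈? S)) ⟩
      T + - w x * T
        ≈⟨ [1-w]* x T ⟩
      (1# - w x) * T
        ≈⟨ *-congˡ (∑-subsets-∋ xs i) ⟩
      (1# - w x) * (- w (lookup xs i) * ∏ (λ x → 1# - w x) (removeAt xs i))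
        ≈⟨ *ₚ.x∙yz≈y∙xz _ _ _ ⟩
      - w (lookup xs i) * ((1# - w x) * ∏ (λ x → 1# - w x) (removeAt xs i))
        ∎
      where T = ∑-subsets xs (λ S → does (i ∈? S))

    -- Now the choice of 1 is forced at `i`, so that no weight remains in front. The test has the
    -- form to which `does (¬? (i ∈? S))` reduces.
    ∑-subsets-∌ : ∀ xs i → ∑-subsets xs (λ S → not (does (i ∈? S))) ≈
                  ∏ (λ x → 1# - w x) (removeAt xs i)
    ∑-subsets-∌ (x ∷ xs) zero = begin
      ∑-subsets (x ∷ xs) (λ S → not (does (zero ∈? S)))
        ≈⟨ ∑-subsets-∷ x xs (λ S → not (does (zero ∈? S))) ⟩
      ∑-subsets xs (λ _ → true) + - w x * ∑-subsets xs (λ _ → false)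
        ≈⟨ +-cong (∑-subsets-true xs) (*-congˡ (∑-0 (subsets (length xs)))) ⟩
      ∏ (λ x → 1# - w x) xs + - w x * 0#
        ≈⟨ +-congˡ (zeroʳ _) ⟩
      ∏ (λ x → 1# - w x) xs + 0#
        ≈⟨ +-identityʳ _ ⟩
      ∏ (λ x → 1# - w x) xs
        ∎
    ∑-subsets-∌ (x ∷ xs) (suc i) = begin
      ∑-subsets (x ∷ xs) (λ S → not (does (suc i ∈? S)))
        ≈⟨ ∑-subsets-∷ x xs (λ S → not (does (suc i ∈? S))) ⟩
      T + - w x * T
        ≈⟨ [1-w]* x T ⟩
      (1# - w x) * T
        ≈⟨ *-congˡ (∑-subsets-∌ xs i) ⟩
      (1# - w x) * ∏ (λ x → 1# - w x) (removeAt xs i)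
        ∎
      where T = ∑-subsets xs (λ S → not (does (i ∈? S)))

  -- Cancellation under a fixed colouring

  module _ (q : Carrier) where

    -- Here `q` stands for 1 + t; the weight is the factor that a single edge contributes to q^e(κ).
    weight : ∀ {n k} → (Fin n → Fin k) → Fin n × Fin n → Carrier
    weight κ e = if does (monochromatic? κ e) then q else 1#

    weight-monochromatic : ∀ {n k} (κ : Fin n → Fin k) {e} → Monochromatic κ e → weight κ e ≡ q
    weight-monochromatic κ {e} mono =
      ≡.cong (if_then q else 1#) (dec-true (monochromatic? κ e) mono)

    weight-nonmonochromatic : ∀ {n k} (κ : Fin n → Fin k) {e} → ¬ Monochromatic κ e →
                              weight κ e ≡ 1#
    weight-nonmonochromatic κ {e} ¬mono =
      ≡.cong (if_then q else 1#) (dec-false (monochromatic? κ e) ¬mono)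

    module _ {n k : ℕ} (κ : Fin n → Fin k) (G : Graph n) (2-connected : TwoEdgeConnected G)
             where

      private
        es : List (Fin n × Fin n)
        es = edges G

        D : Edge G → Carrier
        D e = ∏ (λ e′ → 1# - weight κ e′) (removeAt es e)

      -- Every factor is 1 - q, and one edge has been removed, hence `pred`. The value does not
      -- depend on `e`, which lets the terms for `i` and `j` cancel.
      D-constant : All (Monochromatic κ) es → ∀ e → D e ≈ (1# - q) ^ pred (length es)
      D-constant mono e = trans
        -- As κ is constant, any pair of vertices is monochromatic, so the remaining edges need not
        -- be traced back to edges of G.
        (∏-const {xs = removeAt es e} (All.tabulate λ { {u , v} _ →
          reflexive (≡.cong (λ c → 1# - c) (weight-monochromatic κ
            (connected⇒constant κ G (proj₁ 2-connected) mono u v))) }))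
        (reflexive (≡.cong ((1# - q) ^_) (length-removeAt es e)))

      -- A non-monochromatic edge survives the removal of `e` and contributes the factor 1 - 1.
      D-nonconstant : ¬ All (Monochromatic κ) es → ∀ e → D e ≈ 0#
      D-nonconstant ¬mono e = ∏-0 (Any.map
        (λ ¬m → trans (+-congˡ (-‿cong (reflexive (weight-nonmonochromatic κ ¬m))))
                      (-‿inverseʳ 1#))
        (non-monochromatic κ G 2-connected ¬mono e))

      cancellation : ∀ i j → - weight κ (lookup es i) * D i + q * D j ≈ 0#
      cancellation i j with all? (monochromatic? κ) es
      ... | yes mono = begin
        - weight κ (lookup es i) * D i + q * D j
          -- The edge at `i` is monochromatic as well, so its weight is exactly the `q` that
          -- multiplies the second sum.
          ≈⟨ +-cong (*-cong (-‿cong (reflexive (weight-monochromatic κ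
                               (All.lookup mono (∈-lookup {xs = es} i)))))
                            (D-constant mono i))
                    (*-congˡ (D-constant mono j)) ⟩
        - q * c + q * c   ≈⟨ distribʳ c (- q) q ⟨
        (- q + q) * c     ≈⟨ *-congʳ (-‿inverseˡ q) ⟩
        0# * c            ≈⟨ zeroˡ c ⟩
        0#                ∎
        where c = (1# - q) ^ pred (length es)
      ... | no ¬mono = begin
        - weight κ (lookup es i) * D i + q * D j
          -- The weight of the edge at `i` may be `q` or 1 here; it is multiplied by zero in either
          -- case.
          ≈⟨ +-cong (*-congˡ (D-nonconstant ¬mono i)) (*-congˡ (D-nonconstant ¬mono j)) ⟩
        - weight κ (lookup es i) * 0# + q * 0#   ≈⟨ +-cong (zeroʳ _) (zeroʳ q) ⟩
        0# + 0#                                  ≈⟨ +-identityˡ 0# ⟩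
        0#                                       ∎

    -- Linear combinations of graphs evaluated at a fixed colouring

    evaluate : (X → Carrier) → List (Carrier × X) → Carrier
    evaluate f = ∑ (λ (c , x) → c * f x)

    evaluate-· : (f : X → Carrier) → ∀ d L →
                 evaluate f (map (λ (c , x) → d * c , x) L) ≈ d * evaluate f L
    evaluate-· f d L = begin
      evaluate f (map (λ (c , x) → d * c , x) L)
        ≡⟨ ∑-map (λ (c , x) → c * f x) (λ (c , x) → d * c , x) L ⟩
      ∑ (λ (c , x) → (d * c) * f x) L
        ≈⟨ ∑-cong (λ (c , x) → *-assoc d c (f x)) L ⟩
      ∑ (λ (c , x) → d * (c * f x)) L
        ≈⟨ ∑-*ˡ d (λ (c , x) → c * f x) L ⟩
      d * evaluate f L
        ∎

    module _ {n : ℕ} (G : Graph n) where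

      -- The counterpart of `alternatingSum` over an arbitrary commutative ring; over the polynomial
      -- ring both unfold to the same list.
      signedSubgraphs : {P : Pred (EdgeSet G) p} → Decidable P → List (Carrier × Graph n)
      signedSubgraphs P? =
        map (λ S → (- 1#) ^ ∣ S ∣ , spanning G S) (filter P? (subsets (length (edges G))))

      evaluate-signedSubgraphs :
        {P : Pred (EdgeSet G) p} (P? : Decidable P) (w : Fin n × Fin n → Carrier) →
        evaluate (λ H → ∏ w (edges H)) (signedSubgraphs P?) ≈
        ∑-subsets w (edges G) (λ S → does (P? S))
      evaluate-signedSubgraphs P? w = begin
        evaluate (λ H → ∏ w (edges H)) (signedSubgraphs P?)
          ≡⟨ ∑-map (λ (c , H) → c * ∏ w (edges H)) _ (filter P? (subsets (length (edges G)))) ⟩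
        ∑ (signed w (edges G)) (filter P? (subsets (length (edges G))))
          ≈⟨ ∑-filter P? (signed w (edges G)) (subsets (length (edges G))) ⟩
        ∑-subsets w (edges G) (λ S → does (P? S))
          ∎

      relation : (eᵢ eⱼ : Edge G) → List (Carrier × Graph n)
      relation eᵢ eⱼ =
        signedSubgraphs (λ S → eᵢ ∈? S) ++
        map (λ (c , H) → q * c , H) (signedSubgraphs (λ S → ¬? (eⱼ ∈? S)))

      evaluate-relation :
        TwoEdgeConnected G → ∀ eᵢ eⱼ {k} (κ : Fin n → Fin k) →
        evaluate (λ H → ∏ (weight κ) (edges H)) (relation eᵢ eⱼ) ≈ 0#
      evaluate-relation 2-connected eᵢ eⱼ κ = begin
        evaluate f (relation eᵢ eⱼ)
          ≈⟨ ∑-++ (λ (c , H) → c * f H) L₁ (map (λ (c , H) → q * c , H) L₂) ⟩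
        evaluate f L₁ + evaluate f (map (λ (c , H) → q * c , H) L₂)
          ≈⟨ +-congˡ (evaluate-· f q L₂) ⟩
        evaluate f L₁ + q * evaluate f L₂
          ≈⟨ +-cong (evaluate-signedSubgraphs (λ S → eᵢ ∈? S) w)
                    (*-congˡ (evaluate-signedSubgraphs (λ S → ¬? (eⱼ ∈? S)) w)) ⟩
        ∑-subsets w es (λ S → does (eᵢ ∈? S)) + q * ∑-subsets w es (λ S → not (does (eⱼ ∈? S)))
          ≈⟨ +-cong (∑-subsets-∋ w es eᵢ) (*-congˡ (∑-subsets-∌ w es eⱼ)) ⟩
        - w (lookup es eᵢ) * ∏ (λ e → 1# - w e) (removeAt es eᵢ) +
        q * ∏ (λ e → 1# - w e) (removeAt es eⱼ)
          ≈⟨ cancellation κ G 2-connected eᵢ eⱼ ⟩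
        0#
          ∎
        where
        es = edges G
        w  = weight κ
        f : Graph n → Carrier
        f H = ∏ w (edges H)
        L₁ = signedSubgraphs (λ S → eᵢ ∈? S)
        L₂ = signedSubgraphs (λ S → ¬? (eⱼ ∈? S))

    -- Extensions and sums over colourings

    ^-monochromatic-⊎E :
      ∀ {n N k} (κ : Fin N → Fin k) (G′ : Graph N) (n≤N : n ≤ N) (H : Graph n) →
      q ^ monochromatic (G′ ⊎E[ H ⟨ n≤N ⟩]) κ ≈
      q ^ monochromatic G′ κ * ∏ (weight (λ v → κ (inject≤ v n≤N))) (edges H)
    ^-monochromatic-⊎E κ G′ n≤N H = begin
      q ^ monochromatic (G′ ⊎E[ H ⟨ n≤N ⟩]) κ
        ≈⟨ ^-length-filter (monochromatic? κ) q (edges (G′ ⊎E[ H ⟨ n≤N ⟩])) ⟩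
      ∏ (weight κ) (edges G′ ++ map inject (edges H))
        ≈⟨ ∏-++ (weight κ) (edges G′) (map inject (edges H)) ⟩
      ∏ (weight κ) (edges G′) * ∏ (weight κ) (map inject (edges H))
        -- The added edges join vertices of [n], so their weights see only the restriction of κ to
        -- [n].
        ≈⟨ *-cong (sym (^-length-filter (monochromatic? κ) q (edges G′)))
                  (reflexive (∏-map (weight κ) inject (edges H))) ⟩
      q ^ monochromatic G′ κ * ∏ (weight (λ v → κ (inject≤ v n≤N))) (edges H)
        ∎
      where inject = λ (u , v) → inject≤ u n≤N , inject≤ v n≤N

    -- After the two summations are exchanged, each colouring contributes zero by itself. The
    -- enumeration `κs` and the test `b` may therefore be arbitrary, provided that they do not
    -- depend on the graph `H`.
    evaluate-∑-colourings :
      ∀ {n N k m} (G′ : Graph N) (n≤N : n ≤ N) (κs : Fin m → Fin N → Fin k) (b : Fin m → Bool)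
      (L : List (Carrier × Graph n)) →
      (∀ (κ : Fin n → Fin k) → evaluate (λ H → ∏ (weight κ) (edges H)) L ≈ 0#) →
      evaluate (λ H → sum λ i →
                  if b i then q ^ monochromatic (G′ ⊎E[ H ⟨ n≤N ⟩]) (κs i) else 0#) L ≈ 0#
    evaluate-∑-colourings {n} {N} {k} {m} G′ n≤N κs b L vanishes = begin
      ∑ (λ (c , H) → c * sum (λ i → term H i)) L
        ≈⟨ ∑-cong (λ (c , H) → *-distribˡ-sum c (term H)) L ⟩
      ∑ (λ (c , H) → sum (λ i → c * term H i)) L
        ≈⟨ ∑-sum (λ (c , H) i → c * term H i) L ⟩
      sum (λ i → evaluate (λ H → term H i) L)
        ≈⟨ sum-cong-≋ term-vanishes ⟩
      sum {m} (λ i → 0#)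
        ≈⟨ sum-replicate-zero m ⟩
      0#
        ∎
      where
      term : Graph n → Fin m → Carrier
      term H i = if b i then q ^ monochromatic (G′ ⊎E[ H ⟨ n≤N ⟩]) (κs i) else 0#

      term-vanishes : ∀ i → evaluate (λ H → term H i) L ≈ 0#
      term-vanishes i with b i
      ... | false = trans (∑-cong (λ (c , H) → zeroʳ c) L) (∑-0 L)
      ... | true  = begin
        evaluate (λ H → q ^ monochromatic (G′ ⊎E[ H ⟨ n≤N ⟩]) (κs i)) L
          -- The factor coming from `G′` is the same for all `H` and moves out of the sum.
          ≈⟨ ∑-cong (λ (c , H) → trans (*-congˡ (^-monochromatic-⊎E (κs i) G′ n≤N H))
                                       (*ₚ.x∙yz≈y∙xz c q^ (f H))) L ⟩
        ∑ (λ (c , H) → q^ * (c * f H)) L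
          ≈⟨ ∑-*ˡ q^ (λ (c , H) → c * f H) L ⟩
        q^ * evaluate f L
          -- The hypothesis is applied to the restriction of the colouring to [n].
          ≈⟨ *-congˡ (vanishes (λ v → κs i (inject≤ v n≤N))) ⟩
        q^ * 0#
          ≈⟨ zeroʳ q^ ⟩
        0#
          ∎
        where
        q^ = q ^ monochromatic G′ (κs i)
        f : Graph n → Carrier
        f H = ∏ (weight (λ v → κs i (inject≤ v n≤N))) (edges H)

-- The Tutte symmetric function over the polynomial ring

theorem13 : ∀ {r ℓ : Level} (R : CommutativeRing r ℓ) → let open Tutte R in
    (n : ℕ) (G : Graph n) → TwoEdgeConnected G → (eᵢ eⱼ : Edge G) →
    IsModularRelation
    (alternatingSum G (λ S → eᵢ ∈? S) ⊕ (1# + t) · alternatingSum G (λ S → ¬? (eⱼ ∈? S)))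
theorem13 R n G 2-connected eᵢ eⱼ N n≤N G′ k α = begin
  XB (Ext L n≤N G′) k α
    ≡⟨ ∑-map (λ (c , H) → c * XBᴳ H k α) (λ (c , H) → c , N , G′ ⊎E[ H ⟨ n≤N ⟩]) L ⟩
  evaluate q (λ H → XBᴳ (N , G′ ⊎E[ H ⟨ n≤N ⟩]) k α) L
    -- The test selects the colourings with monomial x^α. Exponents depend on the colouring and the
    -- vertex set [N] only, so all extended graphs share this test.
    ≈⟨ evaluate-∑-colourings q G′ n≤N finToFun
         (λ i → does (Vec.≡-dec ℕ._≟_ (exponents (finToFun {k} {N} i)) α)) L
         (evaluate-relation q G 2-connected eᵢ eⱼ) ⟩
  0#
    ∎
  where
  open Tutte R using (_+_; _*_; 0#; 1#; t; XB; XBᴳ; Ext)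
  open Expansion (PolynomialRing.commutativeRing R)
  open SetoidReasoning (CommutativeRing.setoid (PolynomialRing.commutativeRing R))
  q = 1# + t
  L = relation q G eᵢ eⱼ
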